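{- Let $Q(x,y)=ax^2+bxy+cy^2$ be a primitive positive definite integral binary quadratic form with discriminant $\Delta=b^2-4ac$. (i) For every odd prime $p$, writing $\left(\frac{\Delta}{p}\right)$ for the Legendre symbol, \[ \epsilon_{Q,p}=\begin{cases}1 & \text{if }\left(\frac{\Delta}{p}\right)=0\ (\text{i.e. } p\mid\Delta),\\ 2 & \text{if }\left(\frac{\Delta}{p}\right)=-1,\\ \infty & \text{if }\left(\frac{\Delta}{p}\right)=1.\end{cases} \] (ii) For $p=2$, \[ \epsilon_{Q,2}=\begin{cases}\infty & \text{if }\Delta\equiv 1\pmod 8,\\ 2 & \text{if }\Delta\equiv 5\pmod 8,\\ 3 & \text{if }4\mid\Delta\text{ and }\Delta=-2^3m\text{ with } m \text{ positive and odd},\\ 2 & \text{if }4\mid\Delta\text{ and }\Delta=-2^nm\text{ with } m\text{ positive and odd},\ n\ge 2,\ n\ne 3.\end{cases} \]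
   Context: An integral binary quadratic form $Q(x,y)=ax^2+bxy+cy^2$ has $a,b,c\in\mathbb{Z}$; it is primitive if $\gcd(a,b,c)=1$. For $l\in\mathbb{Z}$ and $k\in\mathbb{Z}_{\ge1}$, write $Q\not\equiv l\pmod k$ if $Q(x,y)\not\equiv l\pmod k$ for all $(x,y)\in\mathbb{Z}^2$. We say $Q$ has a local obstruction modulo $k$ if there exists $l\in\mathbb{Z}$ with $Q\not\equiv l\pmod k$. For a prime $p$, $\epsilon_{Q,p}:=\min\{e\in\mathbb{Z}_{\ge1}\mid Q\text{ has a local obstruction modulo }p^e\}$, with $\epsilon_{Q,p}=\infty$ if $Q$ has no local obstruction modulo $p^e$ for any $e$. -}

module Defs where

open import Data.Bool.Base using (if_then_else_)
open import Data.Fin.Base using (Fin; toℕ)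
open import Data.Fin.Properties using (any?)
open import Data.Integer.Base using (ℤ; +_; _+_; _-_; _*_; _<_; 0ℤ; 1ℤ; -1ℤ)
open import Data.Integer.Divisibility.Signed using (_∣_; _∣?_)
open import Data.Integer.GCD using (gcd)
open import Data.Nat.Base as ℕ using (ℕ)
import Data.Nat.Divisibility as ℕ
open import Data.Product.Base using (∃; _×_)
open import Relation.Binary.PropositionalEquality.Core using (_≡_)
open import Relation.Nullary.Construct.Add.Supremum using (_⁺; [_]; ⊤⁺)
open import Relation.Nullary.Decidable.Core using (⌊_⌋)
open import Relation.Nullary.Negation.Core using (¬_)

infix 4 _≡_[mod_]

_≡_[mod_] : ℤ → ℤ → ℕ → Set
i ≡ j [mod k ] = + k ∣ i - j

Odd : ℕ → Set
Odd m = ¬ (2 ℕ.∣ m)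

-- The form a x² + b x y + c y².
record BinaryQuadraticForm : Set where
  constructor form
  field
    a b c : ℤ

open BinaryQuadraticForm

_⟨_,_⟩ : BinaryQuadraticForm → ℤ → ℤ → ℤ
Q ⟨ x , y ⟩ = a Q * (x * x) + b Q * (x * y) + c Q * (y * y)

discriminant : BinaryQuadraticForm → ℤ
discriminant Q = b Q * b Q - + 4 * (a Q * c Q)

Primitive : BinaryQuadraticForm → Set
Primitive Q = gcd (a Q) (gcd (b Q) (c Q)) ≡ 1ℤ

-- Positivity at integral points.  For integral binary forms this is the same
-- as positivity at all nonzero real points.
PositiveDefinite : BinaryQuadraticForm → Set
PositiveDefinite Q = ∀ x y → ¬ (x ≡ 0ℤ × y ≡ 0ℤ) → 0ℤ < Q ⟨ x , y ⟩

HasLocalObstruction : BinaryQuadraticForm → ℕ → Set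
HasLocalObstruction Q k = ∃ λ (l : ℤ) → ∀ x y → ¬ (Q ⟨ x , y ⟩ ≡ l [mod k ])

-- "The minimum of { n | P n } is v", where ⊤⁺ = ∞ is the minimum of the
-- empty set.  A relation, because emptiness of an arbitrary P is undecidable.
IsMinimum : (ℕ → Set) → ℕ ⁺ → Set
IsMinimum P [ n ] = P n × (∀ m → P m → n ℕ.≤ m)
IsMinimum P ⊤⁺    = ∀ n → ¬ P n

-- ε[ Q , p ]≡ v  states that the invariant ε_{Q,p} ∈ ℕ ∪ {∞} equals v.
ε[_,_]≡_ : BinaryQuadraticForm → ℕ → ℕ ⁺ → Set
ε[ Q , p ]≡ v = IsMinimum (λ e → 1 ℕ.≤ e × HasLocalObstruction Q (p ℕ.^ e)) v

-- The Legendre symbol (d / p), meaningful for odd primes p.  Squares modulo p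
-- are found by searching the residues 0, …, p − 1.
legendre : ℤ → ℕ → ℤ
legendre d p =
  if ⌊ + p ∣? d ⌋ then 0ℤ
  else if ⌊ any? (λ (x : Fin p) → + p ∣? (+ toℕ x * + toℕ x - d)) ⌋ then 1ℤ
  else -1ℤ

{-# OPTIONS --safe #-}
module Submission where

-- If p ∣ a and p ∤ b, then x ↦ Q(x, 1) hits every residue modulo every power of p.
-- When Δ is a nonzero square modulo p (or Δ ≡ 1 mod 8 for p = 2), a swap or a shear
-- of the variables brings Q into this shape, so there is no obstruction.
--
-- When Δ is a nonresidue (or Δ ≡ 5 mod 8), Q hits every residue modulo p but is
-- anisotropic there: p ∣ Q(x, y) forces p ∣ x and p ∣ y, hence p² ∣ Q(x, y), and Q
-- misses p modulo p².
--
-- When p ∣ Δ, primitivity allows p ∤ a.  For odd p, 4aQ is a square modulo p, so it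
-- misses the nonresidues.  For p = 2, aQ = X² + Ny² with N = −Δ/4; if N ≡ 2 mod 4 this
-- hits everything modulo 4 but misses 5 modulo 8, and otherwise it already misses a
-- residue modulo 4.

open import Defs
open import Data.Empty using (⊥; ⊥-elim)
open import Data.Fin.Base as Fin using (Fin; zero; suc; toℕ; fromℕ<; join; splitAt)
open import Data.Fin.Properties using (all?; any?; pigeonhole; toℕ-injective; toℕ-fromℕ<; toℕ<n; join-splitAt; ¬∀⟶∃¬)
import Data.Fin.Properties as Fin
open import Data.Integer.Base
  using (ℤ; +_; -_; _+_; _-_; _*_; 0ℤ; 1ℤ; -1ℤ; +<+)
import Data.Integer.Base as ℤ
open import Data.Integer.DivMod using (n%ℕd<d; a≡a%ℕn+[a/ℕn]*n)
open import Data.Integer.Divisibility.Signed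
open import Data.Integer.GCD using (gcd; gcd-greatest)
import Data.Integer.Properties as ℤ
open import Data.Integer.Tactic.RingSolver using (solve; solve-∀)
open import Data.List.Base using ([]; _∷_)
open import Data.Nat.Base as ℕ using (ℕ; NonZero; z≤n; s≤s)
open import Data.Nat.Coprimality using (Coprime; coprime-Bézout)
import Data.Nat.Divisibility as ℕ
open import Data.Nat.DivMod using (m%n<n; m≡m%n+[m/n]*n)
open import Data.Nat.GCD using (module Bézout)
open import Data.Nat.Induction using (<-wellFounded)
open import Data.Nat.Primality
  using (Prime; irreducible[2]; prime⇒irreducible; prime⇒nonZero; euclidsLemma; ¬prime[1]; prime[2])
import Data.Nat.Properties as ℕ
open import Data.Product.Base using (_×_; _,_; ∃; ∃₂; proj₁; proj₂)
open import Data.Sum.Base as Sum using (_⊎_; inj₁; inj₂)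
open import Function.Base using (_∘_; case_of_)
open import Induction.WellFounded using (Acc; acc)
open import Relation.Binary.PropositionalEquality
open import Relation.Nullary.Construct.Add.Supremum using ([_]; ⊤⁺)
open import Relation.Nullary.Decidable using (Dec; yes; no; ¬?; _→-dec_; toWitness; from-no)
open import Relation.Nullary.Negation using (¬_; contradiction)

open BinaryQuadraticForm

-- Divisibility and residues in the integers.

∣-lin₁ : ∀ {k u w} s → k ∣ u → w ≡ s * u → k ∣ w
∣-lin₁ s k∣u refl = ∣n⇒∣m*n s k∣u

-- Most divisibility claims below reduce to writing the target as an integer combination of known
-- multiples; the coefficients are given by hand and the identity is left to the ring solver.
∣-lin₂ : ∀ {k u v w} s t → k ∣ u → k ∣ v → w ≡ s * u + t * v → k ∣ w
∣-lin₂ s t k∣u k∣v refl = ∣m∣n⇒∣m+n (∣n⇒∣m*n s k∣u) (∣n⇒∣m*n t k∣v)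

∣-lin₃ : ∀ {k t u v w} x y z → k ∣ t → k ∣ u → k ∣ v → w ≡ x * t + y * u + z * v → k ∣ w
∣-lin₃ x y z k∣t k∣u k∣v refl =
  ∣m∣n⇒∣m+n (∣m∣n⇒∣m+n (∣n⇒∣m*n x k∣t) (∣n⇒∣m*n y k∣u)) (∣n⇒∣m*n z k∣v)

∣-small⇒≡0 : ∀ {k z} → ℤ.∣ z ∣ ℕ.< k → + k ∣ z → z ≡ 0ℤ
∣-small⇒≡0 {k} {z} z<k k∣z with ℤ.∣ z ∣ in eq
... | ℕ.zero  = ℤ.∣i∣≡0⇒i≡0 eq
... | ℕ.suc n = contradiction (subst (k ℕ.∣_) eq (∣⇒∣ᵤ k∣z)) (ℕ.>⇒∤ z<k)

residue : ∀ k .{{_ : NonZero k}} z → ∃ λ (r : Fin k) → + k ∣ z - + toℕ r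
residue k z = fromℕ< r<k , divides (z ℤ./ℕ k) (begin
  z - + toℕ (fromℕ< r<k)            ≡⟨ cong (λ r → z - + r) (toℕ-fromℕ< r<k) ⟩
  z - + (z ℤ.%ℕ k)                  ≡⟨ cong (_- + (z ℤ.%ℕ k)) (a≡a%ℕn+[a/ℕn]*n z k) ⟩
  + (z ℤ.%ℕ k) + z ℤ./ℕ k * + k - + (z ℤ.%ℕ k) ≡⟨ lemma (+ (z ℤ.%ℕ k)) _ ⟩
  z ℤ./ℕ k * + k                    ∎)
  where
  open ≡-Reasoning
  r<k = n%ℕd<d z k
  lemma : ∀ r t → r + t - r ≡ t
  lemma = solve-∀

residue-≡⇒∣ : ∀ k .{{_ : NonZero k}} u v → proj₁ (residue k u) ≡ proj₁ (residue k v) → + k ∣ u - v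
residue-≡⇒∣ k u v eq = ∣-lin₂ 1ℤ -1ℤ (proj₂ (residue k u)) v∣
  (lemma u v (+ toℕ (proj₁ (residue k u))))
  where
  v∣ : + k ∣ v - + toℕ (proj₁ (residue k u))
  v∣ = subst (λ r → + k ∣ v - + toℕ r) (sym eq) (proj₂ (residue k v))
  lemma : ∀ u v r → u - v ≡ 1ℤ * (u - r) + -1ℤ * (v - r)
  lemma = solve-∀

cancel-unit : ∀ {k} u v w → k ∣ u * v - 1ℤ → k ∣ u * w → k ∣ w
cancel-unit u v w uv≡1 k∣uw = ∣-lin₂ v (- w) k∣uw uv≡1 (solve (u ∷ v ∷ w ∷ []))

-- Arithmetic modulo a prime.

module _ {p : ℕ} (pp : Prime p) where

  prime∤1 : ¬ + p ∣ 1ℤ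
  prime∤1 p∣1 = ¬prime[1] (subst Prime (ℕ.∣1⇒≡1 (∣⇒∣ᵤ p∣1)) pp)

  euclid : ∀ i j → + p ∣ i * j → + p ∣ i ⊎ + p ∣ j
  euclid i j p∣ij =
    Sum.map ∣ᵤ⇒∣ ∣ᵤ⇒∣ (euclidsLemma ℤ.∣ i ∣ ℤ.∣ j ∣ pp (subst (p ℕ.∣_) (ℤ.abs-* i j) (∣⇒∣ᵤ p∣ij)))

  prime∤* : ∀ i j → ¬ + p ∣ i → ¬ + p ∣ j → ¬ + p ∣ i * j
  prime∤* i j p∤i p∤j p∣ij = Sum.[ p∤i , p∤j ] (euclid i j p∣ij)

  prime∣square : ∀ i → + p ∣ i * i → + p ∣ i
  prime∣square i p∣ii = Sum.[ (λ d → d) , (λ d → d) ] (euclid i i p∣ii)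

  cancel-prime∤ : ∀ i j → ¬ + p ∣ i → + p ∣ i * j → + p ∣ j
  cancel-prime∤ i j p∤i p∣ij = Sum.[ (λ p∣i → contradiction p∣i p∤i) , (λ d → d) ] (euclid i j p∣ij)

  prime∤⇒unit : ∀ i → ¬ + p ∣ i → ∃ λ j → + p ∣ i * j - 1ℤ
  -- The quotient `q` is the sign of `i`; it turns the Bézout inverse of |i| modulo p into an
  -- inverse of i.
  prime∤⇒unit i p∤i with m∣∣m∣ {i}
  ... | divides q ∣i∣≡qi = from-Bézout (coprime-Bézout coprime)
    where
    coprime : Coprime p ℤ.∣ i ∣
    coprime (d∣p , d∣i) with prime⇒irreducible pp d∣p
    ... | inj₁ d≡1  = d≡1
    ... | inj₂ refl = contradiction (∣ᵤ⇒∣ d∣i) p∤i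

    pos : ∀ x y m n → 1 ℕ.+ y ℕ.* n ≡ x ℕ.* m → 1ℤ + + y * + n ≡ + x * + m
    pos x y m n eq = begin
      1ℤ + + y * + n   ≡⟨ cong (λ t → 1ℤ + t) (ℤ.pos-* y n) ⟨
      + (1 ℕ.+ y ℕ.* n) ≡⟨ cong +_ eq ⟩
      + (x ℕ.* m)      ≡⟨ ℤ.pos-* x m ⟩
      + x * + m        ∎
      where open ≡-Reasoning

    from-Bézout : Bézout.Identity 1 p ℤ.∣ i ∣ → ∃ λ j → + p ∣ i * j - 1ℤ
    from-Bézout (Bézout.+- x y eq) = - + y * q , divides (- + x) (begin
      i * (- + y * q) - 1ℤ      ≡⟨ lemma i (+ y) q ⟩
      - (1ℤ + + y * (q * i))    ≡⟨ cong (λ t → - (1ℤ + + y * t)) ∣i∣≡qi ⟨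
      - (1ℤ + + y * + ℤ.∣ i ∣)    ≡⟨ cong -_ (pos x y p ℤ.∣ i ∣ eq) ⟩
      - (+ x * + p)             ≡⟨ ℤ.neg-distribˡ-* (+ x) (+ p) ⟩
      - + x * + p               ∎)
      where
      open ≡-Reasoning
      lemma : ∀ i y q → i * (- y * q) - 1ℤ ≡ - (1ℤ + y * (q * i))
      lemma = solve-∀
    from-Bézout (Bézout.-+ x y eq) = + y * q , divides (+ x) (begin
      i * (+ y * q) - 1ℤ        ≡⟨ lemma i (+ y) q ⟩
      + y * (q * i) - 1ℤ        ≡⟨ cong (λ t → + y * t - 1ℤ) ∣i∣≡qi ⟨
      + y * + ℤ.∣ i ∣ - 1ℤ        ≡⟨ cong (_- 1ℤ) (pos y x ℤ.∣ i ∣ p eq) ⟨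
      1ℤ + + x * + p - 1ℤ       ≡⟨ lemma′ (+ x * + p) ⟩
      + x * + p                 ∎)
      where
      open ≡-Reasoning
      lemma : ∀ i y q → i * (y * q) - 1ℤ ≡ y * (q * i) - 1ℤ
      lemma = solve-∀
      lemma′ : ∀ t → 1ℤ + t - 1ℤ ≡ t
      lemma′ = solve-∀

-- Universal forms, obstructions and completing the square.

Universal : BinaryQuadraticForm → ℕ → Set
Universal Q k = ∀ l → ∃₂ λ x y → Q ⟨ x , y ⟩ ≡ l [mod k ]

universal⇒unobstructed : ∀ Q {k} → Universal Q k → ¬ HasLocalObstruction Q k
universal⇒unobstructed Q univ (l , avoids) = let x , y , eq = univ l in avoids x y eq

-- Multiplication by a unit permutes the residues, so it is enough to find a residue missed by uQ.
-- This allows passing to the completed square, with u = 4a for odd p and u = a for p = 2.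
unit-obstruction : ∀ Q k u v r → + k ∣ u * v - 1ℤ →
                   (∀ x y → ¬ + k ∣ u * Q ⟨ x , y ⟩ - r) → HasLocalObstruction Q k
unit-obstruction Q k u v r uv≡1 avoids =
  v * r , λ x y eq → avoids x y (∣-lin₂ u r eq uv≡1 (lemma u v r (Q ⟨ x , y ⟩)))
  where
  lemma : ∀ u v r q → u * q - r ≡ u * (q - v * r) + r * (u * v - 1ℤ)
  lemma = solve-∀

norm : ∀ a b c x y → + 4 * a * (a * (x * x) + b * (x * y) + c * (y * y)) ≡
       (+ 2 * a * x + b * y) * (+ 2 * a * x + b * y) - (b * b - + 4 * (a * c)) * (y * y)
norm = solve-∀

-- Exchange of the two variables.

swapForm : BinaryQuadraticForm → BinaryQuadraticForm
swapForm (form a b c) = form c b a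

swapForm-⟨⟩ : ∀ Q x y → swapForm Q ⟨ x , y ⟩ ≡ Q ⟨ y , x ⟩
swapForm-⟨⟩ (form a b c) = lemma a b c
  where
  lemma : ∀ a b c x y → c * (x * x) + b * (x * y) + a * (y * y) ≡ a * (y * y) + b * (y * x) + c * (x * x)
  lemma = solve-∀

swapForm-discriminant : ∀ Q → discriminant (swapForm Q) ≡ discriminant Q
swapForm-discriminant (form a b c) = cong (λ t → b * b - + 4 * t) (ℤ.*-comm c a)

swapForm-obstruction : ∀ Q k → HasLocalObstruction Q k → HasLocalObstruction (swapForm Q) k
swapForm-obstruction Q k (l , avoids) =
  l , λ x y eq → avoids y x (subst (λ q → + k ∣ q - l) (swapForm-⟨⟩ Q x y) eq)

IsMinimum-cong : ∀ {P R : ℕ → Set} → (∀ n → P n → R n) → (∀ n → R n → P n) →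
                 ∀ v → IsMinimum P v → IsMinimum R v
IsMinimum-cong P⇒R R⇒P [ n ] (Pn , least) = P⇒R n Pn , λ m Rm → least m (R⇒P m Rm)
IsMinimum-cong P⇒R R⇒P ⊤⁺    empty        = λ n Rn → empty n (R⇒P n Rn)

ε-swapForm : ∀ Q {p} v → ε[ swapForm Q , p ]≡ v → ε[ Q , p ]≡ v
ε-swapForm Q@(form _ _ _) {p} v = IsMinimum-cong
  -- Exchanging twice gives back `Q`, so one transfer lemma serves both directions.
  (λ e (1≤e , obs) → 1≤e , swapForm-obstruction (swapForm Q) (p ℕ.^ e) obs)
  (λ e (1≤e , obs) → 1≤e , swapForm-obstruction Q (p ℕ.^ e) obs)
  v

-- Criteria for the value of ε.

ε≡1 : ∀ Q {p} → HasLocalObstruction Q p → ε[ Q , p ]≡ [ 1 ]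
ε≡1 Q {p} obs =
  (s≤s z≤n , subst (HasLocalObstruction Q) (sym (ℕ.^-identityʳ p)) obs) , λ m (1≤m , _) → 1≤m

ε≡2 : ∀ Q {p} → Universal Q p → HasLocalObstruction Q (p ℕ.* p) → ε[ Q , p ]≡ [ 2 ]
ε≡2 Q {p} univ obs =
  (s≤s z≤n , subst (HasLocalObstruction Q) (cong (p ℕ.*_) (sym (ℕ.^-identityʳ p))) obs) , least
  where
  least : ∀ m → 1 ℕ.≤ m × HasLocalObstruction Q (p ℕ.^ m) → 2 ℕ.≤ m
  least 1 (_ , obs₁) =
    contradiction (subst (HasLocalObstruction Q) (ℕ.^-identityʳ p) obs₁) (universal⇒unobstructed Q univ)
  least (ℕ.suc (ℕ.suc _)) _ = s≤s (s≤s z≤n)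

ε≡∞ : ∀ Q {p} → (∀ e → Universal Q (p ℕ.^ e)) → ε[ Q , p ]≡ ⊤⁺
ε≡∞ Q univ e (_ , obs) = universal⇒unobstructed Q (univ e) obs

-- Reduction to a leading coefficient prime to p.

primitive⇒∤ : ∀ {p} → Prime p → ∀ {a b c} → Primitive (form a b c) →
              + p ∣ a → + p ∣ b → + p ∣ c → ⊥
primitive⇒∤ {p} pp {a} {b} {c} prim p∣a p∣b p∣c =
  prime∤1 pp (subst (+ p ∣_) prim (∣ᵤ⇒∣
    (gcd-greatest {a} {gcd b c} {+ p} (∣⇒∣ᵤ p∣a) (gcd-greatest {b} {c} {+ p} (∣⇒∣ᵤ p∣b) (∣⇒∣ᵤ p∣c)))))

-- If p divided both a and c, then p ∣ Δ would give p ∣ b², hence p ∣ b, against primitivity. So a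
-- or c is prime to p, and an exchange of variables, which keeps Δ, brings it to the front.
wlog-∤a : ∀ {p} → Prime p → ∀ Q → Primitive Q → + p ∣ discriminant Q → ∀ v →
          (∀ Q′ → discriminant Q′ ≡ discriminant Q → ¬ + p ∣ a Q′ → ε[ Q′ , p ]≡ v) →
          ε[ Q , p ]≡ v
wlog-∤a {p} pp Q@(form a b c) prim p∣Δ v prove with + p ∣? a | + p ∣? c
... | no p∤a  | _       = prove Q refl p∤a
... | yes _   | no p∤c  = ε-swapForm Q v (prove (swapForm Q) (swapForm-discriminant Q) p∤c)
... | yes p∣a | yes p∣c = ⊥-elim (primitive⇒∤ pp prim p∣a (prime∣square pp b
  (∣-lin₂ 1ℤ (+ 4 * c) p∣Δ p∣a (lemma a b c))) p∣c)
  where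
  lemma : ∀ a b c → b * b ≡ 1ℤ * (b * b - + 4 * (a * c)) + + 4 * c * a
  lemma = solve-∀

-- Universality modulo all powers of p.

-- Modulo p the polynomial ax² + bx + c is linear with invertible slope, so every
-- root of it modulo p^e lifts to p^(e+1), already from e = 0.
hensel : ∀ {p} → Prime p → ∀ a b c → + p ∣ a → ¬ + p ∣ b → ∀ e l →
         ∃ λ x → + (p ℕ.^ e) ∣ form a b c ⟨ x , 1ℤ ⟩ - l
hensel pp a b c p∣a p∤b ℕ.zero l = 0ℤ , divides (form a b c ⟨ 0ℤ , 1ℤ ⟩ - l) (sym (ℤ.*-identityʳ _))
hensel {p} pp a b c p∣a@(divides a′ refl) p∤b (ℕ.suc e) l
  with x , divides q f≡ ← hensel pp a b c p∣a p∤b e l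
     | v , divides w bv≡1 ← prime∤⇒unit pp b p∤b =
  -- A Newton step. The current error is qP, and `v` inverts b modulo p, so the linear term b·t
  -- cancels the error up to a multiple of pP. The change in the quadratic term is s·pP because p ∣
  -- a.
  let P = + (p ℕ.^ e)
      t = P * (q * v)
      s = a′ * (q * v) * (t - + 2 * x)
  in x - t , subst (λ k → k ∣ form a b c ⟨ x - t , 1ℤ ⟩ - l) (sym (ℤ.pos-* p (p ℕ.^ e)))
       (divides (s - q * w) (begin
         form a b c ⟨ x - t , 1ℤ ⟩ - l
           ≡⟨ expand a′ (+ p) b c x l q v P ⟩
         form a b c ⟨ x , 1ℤ ⟩ - l - q * P - q * P * (b * v - 1ℤ) + s * (+ p * P)
           ≡⟨ cong₂ (λ m n → m - q * P - q * P * n + s * (+ p * P)) f≡ bv≡1 ⟩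
         q * P - q * P - q * P * (w * + p) + s * (+ p * P)
           ≡⟨ collect (+ p) q w P s ⟩
         (s - q * w) * (+ p * P) ∎))
  where
  open ≡-Reasoning
  expand : ∀ a′ p b c x l q v P → let t = P * (q * v) in
    a′ * p * ((x - t) * (x - t)) + b * ((x - t) * 1ℤ) + c * (1ℤ * 1ℤ) - l ≡
    (a′ * p * (x * x) + b * (x * 1ℤ) + c * (1ℤ * 1ℤ) - l) - q * P - q * P * (b * v - 1ℤ)
      + (a′ * (q * v) * (t - + 2 * x)) * (p * P)
  expand = solve-∀
  collect : ∀ p q w P s → q * P - q * P - q * P * (w * p) + s * (p * P) ≡ (s - q * w) * (p * P)
  collect = solve-∀

hensel-universal : ∀ {p} → Prime p → ∀ Q → + p ∣ a Q → ¬ + p ∣ b Q → ∀ e → Universal Q (p ℕ.^ e)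
hensel-universal pp (form a b c) p∣a p∤b e l =
  let x , eq = hensel pp a b c p∣a p∤b e l in x , 1ℤ , eq

hensel-universal′ : ∀ {p} → Prime p → ∀ Q → + p ∣ c Q → ¬ + p ∣ b Q → ∀ e → Universal Q (p ℕ.^ e)
hensel-universal′ {p} pp Q@(form _ _ _) p∣c p∤b e l =
  let x , y , eq = hensel-universal pp (swapForm Q) p∣c p∤b e l
  in y , x , subst (λ q → + (p ℕ.^ e) ∣ q - l) (swapForm-⟨⟩ Q x y) eq

-- Anisotropy modulo p.

anisotropic⇒obstruction : ∀ {p} → Prime p → ∀ Q →
  (∀ x y → + p ∣ Q ⟨ x , y ⟩ → + p ∣ x × + p ∣ y) → HasLocalObstruction Q (p ℕ.* p)
anisotropic⇒obstruction {p} pp Q@(form a b c) aniso = + p , λ x y pp∣ →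
  let pp∣′ : + p * + p ∣ Q ⟨ x , y ⟩ - + p
      pp∣′ = subst (λ k → k ∣ Q ⟨ x , y ⟩ - + p) (ℤ.pos-* p p) pp∣
      p∣pp : + p ∣ + p * + p
      p∣pp = ∣n⇒∣m*n (+ p) ∣-refl
      p∣x , p∣y = aniso x y (∣-lin₂ 1ℤ 1ℤ (∣-trans p∣pp pp∣′) (∣-refl {+ p}) (split (Q ⟨ x , y ⟩) (+ p)))
  in absurd x y p∣x p∣y pp∣′
  where
  instance _ = prime⇒nonZero pp
  split : ∀ q p → q ≡ 1ℤ * (q - p) + 1ℤ * p
  split = solve-∀
  scale : ∀ a b c s t p →
    p * 1ℤ ≡ (a * (s * s) + b * (s * t) + c * (t * t)) * (p * p)
           + -1ℤ * (a * (s * p * (s * p)) + b * (s * p * (t * p)) + c * (t * p * (t * p)) - p)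
  scale = solve-∀
  absurd : ∀ x y → + p ∣ x → + p ∣ y → ¬ + p * + p ∣ Q ⟨ x , y ⟩ - + p
  -- Both Q(x, y) and Q(x, y) - p are multiples of p², hence so is p; cancelling one factor p leaves
  -- p ∣ 1.
  absurd _ _ (divides s refl) (divides t refl) pp∣ = prime∤1 pp (*-cancelˡ-∣ (+ p)
    (∣-lin₂ (a * (s * s) + b * (s * t) + c * (t * t)) -1ℤ ∣-refl pp∣ (scale a b c s t (+ p))))

-- Squares modulo an odd prime.

odd-prime : ∀ {p} → Prime p → p ≢ 2 → ∃ λ h → p ≡ ℕ.suc (h ℕ.+ h)
odd-prime {p} pp p≢2 with p ℕ.% 2 | m%n<n p 2 | m≡m%n+[m/n]*n p 2
... | 0 | _ | p≡ = case prime⇒irreducible pp (ℕ.divides (p ℕ./ 2) p≡) of λ where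
  (inj₁ ())
  (inj₂ 2≡p) → contradiction (sym 2≡p) p≢2
... | 1 | _ | p≡ = p ℕ./ 2 , trans p≡ (cong ℕ.suc (trans (ℕ.*-comm (p ℕ./ 2) 2)
  (cong (p ℕ./ 2 ℕ.+_) (ℕ.+-identityʳ (p ℕ./ 2)))))
... | ℕ.suc (ℕ.suc _) | s≤s (s≤s ()) | _

prime∤2 : ∀ {p} → Prime p → p ≢ 2 → ¬ + p ∣ + 2
prime∤2 pp p≢2 p∣2 with irreducible[2] (∣⇒∣ᵤ p∣2)
... | inj₁ refl = ¬prime[1] pp
... | inj₂ p≡2  = p≢2 p≡2

∣-difference⇒≡ : ∀ {k i j} → i ℕ.< k → j ℕ.< k → + k ∣ + i - + j → i ≡ j
∣-difference⇒≡ {k} {i} {j} i<k j<k k∣i-j =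
  ℤ.+-injective (ℤ.i-j≡0⇒i≡j (+ i) (+ j) (∣-small⇒≡0 {z = + i - + j} small k∣i-j))
  where
  small : ℤ.∣ + i - + j ∣ ℕ.< k
  small = ℕ.≤-<-trans
    (subst (λ z → ℤ.∣ z ∣ ℕ.≤ i ℕ.⊔ j) (sym (ℤ.m-n≡m⊖n i j)) (ℤ.∣m⊝n∣≤m⊔n i j))
    (ℕ.⊔-lub i<k j<k)

module _ {p : ℕ} (h : ℕ) (pp : Prime p) (p≡ : p ≡ ℕ.suc (h ℕ.+ h)) where

  private
    instance _ = prime⇒nonZero pp

    sum<p : ∀ {i j} → i ℕ.≤ h → j ℕ.≤ h → i ℕ.+ j ℕ.< p
    sum<p i≤h j≤h = subst (_ ℕ.<_) (sym p≡) (s≤s (ℕ.+-mono-≤ i≤h j≤h))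

    half<p : ∀ {i} → i ℕ.≤ h → i ℕ.< p
    half<p {i} i≤h = ℕ.≤-<-trans (ℕ.m≤m+n i 0) (sum<p i≤h z≤n)

  -- p divides i - j or i + j, and both are below p in absolute value because i + j ≤ 2h = p - 1.
  -- Hence 0, ..., h have (p+1)/2 distinct squares modulo p.
  squares-injective : ∀ {i j} → i ℕ.≤ h → j ℕ.≤ h → + p ∣ + i * + i - + j * + j → i ≡ j
  squares-injective {i} {j} i≤h j≤h p∣i²-j² with euclid pp (+ i - + j) (+ i + + j)
    (subst (+ p ∣_) (factor (+ i) (+ j)) p∣i²-j²)
    where
    factor : ∀ i j → i * i - j * j ≡ (i - j) * (i + j)
    factor = solve-∀
  ... | inj₁ p∣i-j = ∣-difference⇒≡ (half<p i≤h) (half<p j≤h) p∣i-j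
  ... | inj₂ p∣i+j = trans (ℕ.m+n≡0⇒m≡0 i i+j≡0) (sym (ℕ.m+n≡0⇒n≡0 i i+j≡0))
    where
    i+j≡0 : i ℕ.+ j ≡ 0
    i+j≡0 = ℤ.+-injective (∣-small⇒≡0 {z = + i + + j} (sum<p i≤h j≤h) p∣i+j)

  -- A residue r above h is replaced by p - r, which has the same square and is at most h.
  half-residue : ∀ X → ∃ λ (x : Fin (ℕ.suc h)) → + p ∣ X * X - + toℕ x * + toℕ x
  half-residue X with residue p X
  ... | r , p∣X-r with toℕ r ℕ.≤? h
  ... | yes r≤h = fromℕ< (s≤s r≤h) ,
    subst (λ t → + p ∣ X * X - + t * + t) (sym (toℕ-fromℕ< (s≤s r≤h)))
      (∣-lin₁ (X + + toℕ r) p∣X-r (factor X (+ toℕ r)))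
    where
    factor : ∀ X r → X * X - r * r ≡ (X + r) * (X - r)
    factor = solve-∀
  ... | no r≰h = fromℕ< (s≤s s≤h) ,
    subst (λ t → + p ∣ X * X - t * t) (sym (trans (cong +_ (toℕ-fromℕ< (s≤s s≤h))) s≡p-r))
      (∣-lin₂ (X + + toℕ r) (+ 2 * + toℕ r - + p) p∣X-r ∣-refl (factor X (+ toℕ r) (+ p)))
    where
    r≤p = ℕ.<⇒≤ (toℕ<n r)
    s≤h : p ℕ.∸ toℕ r ℕ.≤ h
    s≤h = ℕ.m≤n+o⇒m∸n≤o p (toℕ r) (subst (ℕ._≤ toℕ r ℕ.+ h) (sym p≡) (ℕ.+-monoˡ-≤ h (ℕ.≰⇒> r≰h)))
    s≡p-r : + (p ℕ.∸ toℕ r) ≡ + p - + toℕ r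
    s≡p-r = trans (sym (ℤ.⊖-≥ r≤p)) (sym (ℤ.m-n≡m⊖n p (toℕ r)))
    factor : ∀ X r p → X * X - (p - r) * (p - r) ≡ (X + r) * (X - r) + (+ 2 * r - p) * p
    factor = solve-∀

  -- If every residue had a root among 0, ..., h, choosing roots would inject p residues into h + 1
  -- < p numbers.
  nonresidue : ∃ λ n → ∀ X → ¬ + p ∣ X * X - n
  nonresidue with all? (λ (n : Fin p) → any? (λ (x : Fin (ℕ.suc h)) → + p ∣? (+ toℕ x * + toℕ x - + toℕ n)))
  ... | yes root = ⊥-elim (let i , j , i<j , eq = pigeonhole half<p′ (proj₁ ∘ root) in
    Fin.<⇒≢ i<j (toℕ-injective (∣-difference⇒≡ (toℕ<n i) (toℕ<n j) (∣-lin₂ -1ℤ 1ℤ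
      (proj₂ (root i)) (subst (λ x → + p ∣ + toℕ x * + toℕ x - + toℕ j) (sym eq) (proj₂ (root j)))
      (cancel (+ toℕ i) (+ toℕ j) (+ toℕ (proj₁ (root i)) * + toℕ (proj₁ (root i))))))))
    where
    0<h : ∀ g → p ≡ ℕ.suc (g ℕ.+ g) → 0 ℕ.< g
    0<h ℕ.zero    refl = contradiction pp ¬prime[1]
    0<h (ℕ.suc g) _    = s≤s z≤n
    half<p′ : ℕ.suc h ℕ.< p
    half<p′ = subst (ℕ.suc h ℕ.<_) (sym p≡) (s≤s (ℕ.+-monoˡ-≤ h (0<h h p≡)))
    cancel : ∀ i j x → i - j ≡ -1ℤ * (x - i) + 1ℤ * (x - j)
    cancel = solve-∀
  ... | no ¬root =
    -- Decidability turns the failure into a residue `n` with no root in 0, ..., h, and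
    -- `half-residue` extends this to all integers.
    let n , rootless = ¬∀⟶∃¬ p _ (λ n → any? (λ (x : Fin (ℕ.suc h)) → + p ∣? (+ toℕ x * + toℕ x - + toℕ n))) ¬root
    in + toℕ n , λ X p∣X²-n → let x , p∣X²-x² = half-residue X in
         rootless (x , ∣-lin₂ 1ℤ -1ℤ p∣X²-n p∣X²-x² (cancel X (+ toℕ x) (+ toℕ n)))
    where
    cancel : ∀ X x n → x * x - n ≡ 1ℤ * (X * X - n) + -1ℤ * (X * X - x * x)
    cancel = solve-∀

  -- X² and dY² + n take (p+1)/2 values modulo p each, so they share one.
  represented : ∀ d → ¬ + p ∣ d → ∀ n → ∃₂ λ X Y → + p ∣ X * X - d * (Y * Y) - n
  represented d p∤d n = collision (pigeonhole p<2h+2 class)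
    where
    value : Fin (ℕ.suc h) ⊎ Fin (ℕ.suc h) → ℤ
    value (inj₁ i) = + toℕ i * + toℕ i
    value (inj₂ j) = d * (+ toℕ j * + toℕ j) + n

    class : Fin (ℕ.suc h ℕ.+ ℕ.suc h) → Fin p
    class i = proj₁ (residue p (value (splitAt (ℕ.suc h) i)))

    p<2h+2 : p ℕ.< ℕ.suc h ℕ.+ ℕ.suc h
    p<2h+2 = subst (ℕ._< ℕ.suc h ℕ.+ ℕ.suc h) (sym p≡) (s≤s (ℕ.+-monoʳ-< h (ℕ.n<1+n h)))

    bound : ∀ (i : Fin (ℕ.suc h)) → toℕ i ℕ.≤ h
    bound i = ℕ.≤-pred (toℕ<n i)

    cancel-n : ∀ d x y n → d * (x * x - y * y) ≡ 1ℤ * (d * (x * x) + n - (d * (y * y) + n))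
    cancel-n = solve-∀
    flip-n : ∀ d x y n → x * x - d * (y * y) - n ≡ -1ℤ * (d * (y * y) + n - x * x)
    flip-n = solve-∀
    keep-n : ∀ d x y n → x * x - d * (y * y) - n ≡ 1ℤ * (x * x - (d * (y * y) + n))
    keep-n = solve-∀

    shared : ∀ s t → s ≢ t → + p ∣ value s - value t → ∃₂ λ X Y → + p ∣ X * X - d * (Y * Y) - n
    -- A collision within one family contradicts `squares-injective`, after cancelling d in the
    -- second family. Only a mixed collision remains, and it is the representation sought.
    shared (inj₁ i) (inj₁ j) i≢j eq =
      contradiction (cong inj₁ (toℕ-injective (squares-injective (bound i) (bound j) eq))) i≢j
    shared (inj₂ i) (inj₂ j) i≢j eq =
      contradiction (cong inj₂ (toℕ-injective (squares-injective (bound i) (bound j)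
        (cancel-prime∤ pp d _ p∤d (∣-lin₁ 1ℤ eq (cancel-n d (+ toℕ i) (+ toℕ j) n)))))) i≢j
    shared (inj₁ i) (inj₂ j) _ eq = + toℕ i , + toℕ j , ∣-lin₁ 1ℤ eq (keep-n d (+ toℕ i) (+ toℕ j) n)
    shared (inj₂ i) (inj₁ j) _ eq = + toℕ j , + toℕ i , ∣-lin₁ -1ℤ eq (flip-n d (+ toℕ j) (+ toℕ i) n)

    collision : (∃₂ λ i j → i Fin.< j × class i ≡ class j) → ∃₂ λ X Y → + p ∣ X * X - d * (Y * Y) - n
    collision (i , j , i<j , eq) = shared (splitAt (ℕ.suc h) i) (splitAt (ℕ.suc h) j)
      (λ same → Fin.<⇒≢ i<j (splitAt-injective same))
      (residue-≡⇒∣ p (value (splitAt (ℕ.suc h) i)) (value (splitAt (ℕ.suc h) j)) eq)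
      where
      splitAt-injective : splitAt (ℕ.suc h) i ≡ splitAt (ℕ.suc h) j → i ≡ j
      splitAt-injective same = trans (sym (join-splitAt (ℕ.suc h) (ℕ.suc h) i))
        (trans (cong (join (ℕ.suc h) (ℕ.suc h)) same) (join-splitAt (ℕ.suc h) (ℕ.suc h) j))

-- The Legendre symbol.

legendre≡0⇒ : ∀ d p → legendre d p ≡ 0ℤ → + p ∣ d
legendre≡0⇒ d p eq with + p ∣? d | any? (λ (x : Fin p) → + p ∣? (+ toℕ x * + toℕ x - d))
... | yes p∣d | _     = p∣d
... | no _    | yes _ = case eq of λ ()
... | no _    | no _  = case eq of λ ()

legendre≡1⇒ : ∀ d p → legendre d p ≡ 1ℤ → ¬ + p ∣ d × ∃ λ s → + p ∣ s * s - d
legendre≡1⇒ d p eq with + p ∣? d | any? (λ (x : Fin p) → + p ∣? (+ toℕ x * + toℕ x - d))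
... | yes _  | _            = case eq of λ ()
... | no p∤d | yes (x , s²) = p∤d , + toℕ x , s²
... | no _   | no _         = case eq of λ ()

-- The search tests only 0, ..., p - 1; reducing s modulo p extends the failure to every integer.
legendre≡-1⇒ : ∀ d p .{{_ : NonZero p}} → legendre d p ≡ -1ℤ → ¬ + p ∣ d × (∀ s → ¬ + p ∣ s * s - d)
legendre≡-1⇒ d p eq with + p ∣? d | any? (λ (x : Fin p) → + p ∣? (+ toℕ x * + toℕ x - d))
... | yes _  | _        = case eq of λ ()
... | no _   | yes _    = case eq of λ ()
... | no p∤d | no ¬root = p∤d , λ s p∣s²-d → let r , p∣s-r = residue p s in
  ¬root (r , ∣-lin₂ 1ℤ (- (s + + toℕ r)) p∣s²-d p∣s-r (shift s (+ toℕ r) d))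
  where
  shift : ∀ s r d → r * r - d ≡ 1ℤ * (s * s - d) + - (s + r) * (s - r)
  shift = solve-∀

-- Odd primes: the ramified, inert and split cases.

prime∤4 : ∀ {p} → Prime p → p ≢ 2 → ¬ + p ∣ + 4
prime∤4 pp p≢2 = prime∤* pp (+ 2) (+ 2) (prime∤2 pp p≢2) (prime∤2 pp p≢2)

ramified : ∀ {p} → Prime p → p ≢ 2 → ∀ Q → + p ∣ discriminant Q → ¬ + p ∣ a Q → HasLocalObstruction Q p
ramified {p} pp p≢2 Q@(form a b c) p∣Δ p∤a =
  let h , p≡      = odd-prime pp p≢2
      n , rootless = nonresidue h pp p≡
      v , unit     = prime∤⇒unit pp (+ 4 * a) (prime∤* pp (+ 4) a (prime∤4 pp p≢2) p∤a)
  in unit-obstruction Q p (+ 4 * a) v n unit λ x y eq → rootless (+ 2 * a * x + b * y)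
       (∣-lin₂ 1ℤ (y * y) eq p∣Δ (square a b c x y n))
  where
  square : ∀ a b c x y n → let X = + 2 * a * x + b * y in
    X * X - n ≡ 1ℤ * (+ 4 * a * (a * (x * x) + b * (x * y) + c * (y * y)) - n)
              + y * y * (b * b - + 4 * (a * c))
  square = solve-∀

-- If p ∣ a, then Δ ≡ b² modulo p would be a square.
inert⇒∤a : ∀ {p} → ∀ Q → (∀ s → ¬ + p ∣ s * s - discriminant Q) → ¬ + p ∣ a Q
inert⇒∤a {p} (form a b c) nonsquare p∣a = nonsquare b (∣-lin₁ (+ 4 * c) p∣a (lemma a b c))
  where
  lemma : ∀ a b c → b * b - (b * b - + 4 * (a * c)) ≡ + 4 * c * a
  lemma = solve-∀

-- `represented` solves X² - ΔY² ≡ 4al. Inverting 2a gives x with 2ax + bY ≡ X, so 4aQ(x, Y) ≡ 4al,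
-- and 4a cancels.
inert-universal : ∀ {p} → Prime p → p ≢ 2 → ∀ Q → ¬ + p ∣ discriminant Q → ¬ + p ∣ a Q → Universal Q p
inert-universal {p} pp p≢2 Q@(form a b c) p∤Δ p∤a l =
  let h , p≡    = odd-prime pp p≢2
      X , Y , eq = represented h pp p≡ (discriminant Q) p∤Δ (+ 4 * a * l)
      v , unit   = prime∤⇒unit pp (+ 2 * a) (prime∤* pp (+ 2) a (prime∤2 pp p≢2) p∤a)
      x          = v * (X - b * Y)
  in x , Y , cancel-prime∤ pp (+ 4 * a) _ (prime∤* pp (+ 4) a (prime∤4 pp p≢2) p∤a)
       (∣-lin₂ 1ℤ ((+ 2 * a * x + b * Y + X) * (X - b * Y)) eq unit (complete a b c l v X Y))
  where
  complete : ∀ a b c l v X Y → let x = v * (X - b * Y) in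
    + 4 * a * (a * (x * x) + b * (x * Y) + c * (Y * Y) - l) ≡
    1ℤ * (X * X - (b * b - + 4 * (a * c)) * (Y * Y) - + 4 * a * l)
    + (+ 2 * a * x + b * Y + X) * (X - b * Y) * (+ 2 * a * v - 1ℤ)
  complete = solve-∀

-- Put X = 2ax + by, so that X² ≡ Δy². If p ∤ y, dividing by y² would make Δ a square. Hence p ∣ y,
-- then p ∣ X, and so p ∣ x because 2a is a unit.
inert-anisotropic : ∀ {p} → Prime p → p ≢ 2 → ∀ Q → (∀ s → ¬ + p ∣ s * s - discriminant Q) →
                    ∀ x y → + p ∣ Q ⟨ x , y ⟩ → + p ∣ x × + p ∣ y
inert-anisotropic {p} pp p≢2 Q@(form a b c) nonsquare x y p∣Q = p∣x (+ p ∣? y) , p∣y (+ p ∣? y)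
  where
  X = + 2 * a * x + b * y
  Δ = b * b - + 4 * (a * c)

  p∣X²-Δy² : + p ∣ X * X - Δ * (y * y)
  p∣X²-Δy² = ∣-lin₁ (+ 4 * a) p∣Q (sym (norm a b c x y))

  p∣y : Dec (+ p ∣ y) → + p ∣ y
  p∣y (yes p∣y) = p∣y
  p∣y (no p∤y)  =
    let v , unit = prime∤⇒unit pp y p∤y in
    contradiction (∣-lin₂ (v * v) (Δ * (y * v + 1ℤ)) p∣X²-Δy² unit (lemma X Δ y v)) (nonsquare (X * v))
    where
    lemma : ∀ X Δ y v → X * v * (X * v) - Δ ≡ v * v * (X * X - Δ * (y * y)) + Δ * (y * v + 1ℤ) * (y * v - 1ℤ)
    lemma = solve-∀

  p∣x : Dec (+ p ∣ y) → + p ∣ x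
  p∣x y? = cancel-prime∤ pp (+ 2 * a) x (prime∤* pp (+ 2) a (prime∤2 pp p≢2) (inert⇒∤a Q nonsquare))
    (∣-lin₂ 1ℤ (- b) (prime∣square pp X (∣-lin₂ 1ℤ (Δ * y) p∣X²-Δy² (p∣y y?) (lemma X Δ y))) (p∣y y?)
      (lemma′ a b x y))
    where
    lemma : ∀ X Δ y → X * X ≡ 1ℤ * (X * X - Δ * (y * y)) + Δ * y * y
    lemma = solve-∀
    lemma′ : ∀ a b x y → + 2 * a * x ≡ 1ℤ * (+ 2 * a * x + b * y) + - b * y
    lemma′ = solve-∀

-- A square root s of Δ gives the zero (α, 1) of Q modulo p with 2aα + b ≡ s; after
-- the shear x ↦ x + αy the last coefficient vanishes modulo p.
split-universal : ∀ {p} → Prime p → p ≢ 2 → ∀ Q s → ¬ + p ∣ discriminant Q →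
                  + p ∣ s * s - discriminant Q → ∀ e → Universal Q (p ℕ.^ e)
split-universal {p} pp p≢2 Q@(form a b c) s p∤Δ s²≡Δ with + p ∣? a
... | yes p∣a = hensel-universal pp Q p∣a λ p∣b → p∤Δ (∣-lin₂ b (- (+ 4 * c)) p∣b p∣a (lemma a b c))
  where
  lemma : ∀ a b c → b * b - + 4 * (a * c) ≡ b * b + - (+ 4 * c) * a
  lemma = solve-∀
... | no p∤a = λ e l →
  let x , y , eq = hensel-universal′ pp sheared p∣c′ p∤b′ e l
  in x + α * y , y , subst (λ q → + (p ℕ.^ e) ∣ q - l) (shear a b c α x y) eq
  where
  inverse = prime∤⇒unit pp (+ 2 * a) (prime∤* pp (+ 2) a (prime∤2 pp p≢2) p∤a)
  v = proj₁ inverse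
  α = v * (s - b)
  -- These are the coefficients of Q(x + αy, y). The middle one is b′ ≡ s, a unit modulo p, and the
  -- last one, c′ = Q(α, 1), satisfies 4ac′ = b′² - Δ ≡ 0.
  sheared = form a (+ 2 * a * α + b) (a * (α * α) + b * (α * 1ℤ) + c * (1ℤ * 1ℤ))

  shear : ∀ a b c α x y →
    a * (x * x) + (+ 2 * a * α + b) * (x * y) + (a * (α * α) + b * (α * 1ℤ) + c * (1ℤ * 1ℤ)) * (y * y) ≡
    a * ((x + α * y) * (x + α * y)) + b * ((x + α * y) * y) + c * (y * y)
  shear = solve-∀

  b′-s : ∀ a b s v → + 2 * a * (v * (s - b)) + b - s ≡ (s - b) * (+ 2 * a * v - 1ℤ)
  b′-s = solve-∀

  b′≡s : + p ∣ + 2 * a * α + b - s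
  b′≡s = ∣-lin₁ (s - b) (proj₂ inverse) (b′-s a b s v)

  p∤b′ : ¬ + p ∣ + 2 * a * α + b
  p∤b′ p∣b′ = p∤Δ (∣-lin₃ s (- s) -1ℤ p∣b′ b′≡s s²≡Δ (lemma (+ 2 * a * α + b) s (discriminant Q)))
    where
    lemma : ∀ b′ s Δ → Δ ≡ s * b′ + - s * (b′ - s) + -1ℤ * (s * s - Δ)
    lemma = solve-∀

  p∣c′ : + p ∣ a * (α * α) + b * (α * 1ℤ) + c * (1ℤ * 1ℤ)
  p∣c′ = cancel-prime∤ pp (+ 4 * a) _ (prime∤* pp (+ 4) a (prime∤4 pp p≢2) p∤a)
    (∣-lin₂ (+ 2 * a * α + b + s) 1ℤ b′≡s s²≡Δ (lemma a b c α s))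
    where
    lemma : ∀ a b c α s → + 4 * a * (a * (α * α) + b * (α * 1ℤ) + c * (1ℤ * 1ℤ)) ≡
      (+ 2 * a * α + b + s) * (+ 2 * a * α + b - s) + 1ℤ * (s * s - (b * b - + 4 * (a * c)))
    lemma = solve-∀

-- The prime 2: parity and odd discriminants.

parity : ∀ z → (∃ λ u → z ≡ + 2 * u) ⊎ (∃ λ u → z ≡ 1ℤ + + 2 * u)
parity z with residue 2 z
... | zero     , divides u z≡ = inj₁ (u , trans (lemma z) (trans z≡ (ℤ.*-comm u (+ 2))))
  where
  lemma : ∀ z → z ≡ z - 0ℤ
  lemma = solve-∀
... | suc zero , divides u z≡ = inj₂ (u , trans (lemma z) (cong (λ t → 1ℤ + t) (trans z≡ (ℤ.*-comm u (+ 2)))))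
  where
  lemma : ∀ z → z ≡ 1ℤ + (z - 1ℤ)
  lemma = solve-∀

2∤⇒1+2u : ∀ z → ¬ + 2 ∣ z → ∃ λ u → z ≡ 1ℤ + + 2 * u
2∤⇒1+2u z 2∤z with parity z
... | inj₁ (u , refl) = contradiction (∣m⇒∣m*n u ∣-refl) 2∤z
... | inj₂ odd        = odd

odd+odd : ∀ i j → ¬ + 2 ∣ i → ¬ + 2 ∣ j → + 2 ∣ i + j
odd+odd i j 2∤i 2∤j with 2∤⇒1+2u i 2∤i | 2∤⇒1+2u j 2∤j
... | u , refl | v , refl = divides (1ℤ + u + v) (lemma u v)
  where
  lemma : ∀ u v → 1ℤ + + 2 * u + (1ℤ + + 2 * v) ≡ (1ℤ + u + v) * + 2
  lemma = solve-∀

odd-square : ∀ z → ¬ + 2 ∣ z → + 8 ∣ z * z - 1ℤ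
odd-square z 2∤z =
  let r , 8∣z-r = residue 8 z
      2∤r : ¬ + 2 ∣ + toℕ r
      2∤r = λ 2∣r → 2∤z (∣-lin₂ 1ℤ 1ℤ (∣-trans (divides (+ 4) refl) 8∣z-r) 2∣r (split z (+ toℕ r)))
  in ∣-lin₂ (z + + toℕ r) 1ℤ 8∣z-r (table r 2∤r) (factor z (+ toℕ r))
  where
  -- The finitely many residues are settled by evaluating a decision procedure; the later tables
  -- work in the same way.
  table : ∀ (r : Fin 8) → ¬ + 2 ∣ + toℕ r → + 8 ∣ + toℕ r * + toℕ r - 1ℤ
  table = toWitness {a? = all? λ r → ¬? (+ 2 ∣? + toℕ r) →-dec (+ 8 ∣? (+ toℕ r * + toℕ r - 1ℤ))} _
  split : ∀ z r → z ≡ 1ℤ * (z - r) + 1ℤ * r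
  split = solve-∀
  factor : ∀ z r → z * z - 1ℤ ≡ (z + r) * (z - r) + 1ℤ * (r * r - 1ℤ)
  factor = solve-∀

-- Q(0, 0) = 0 and Q(1, 0) = a cover both classes.
odd-universal₂ : ∀ Q → ¬ + 2 ∣ a Q → Universal Q 2
odd-universal₂ (form a b c) 2∤a l with parity l
... | inj₁ (u , refl) = 0ℤ , 0ℤ , divides (- u) (lemma a b c u)
  where
  lemma : ∀ a b c u → a * (0ℤ * 0ℤ) + b * (0ℤ * 0ℤ) + c * (0ℤ * 0ℤ) - + 2 * u ≡ - u * + 2
  lemma = solve-∀
... | inj₂ (u , refl) with 2∤⇒1+2u a 2∤a
... | w , refl = 1ℤ , 0ℤ , divides (w - u) (lemma w b c u)
  where
  lemma : ∀ w b c u → (1ℤ + + 2 * w) * (1ℤ * 1ℤ) + b * (1ℤ * 0ℤ) + c * (0ℤ * 0ℤ) - (1ℤ + + 2 * u) ≡ (w - u) * + 2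
  lemma = solve-∀

-- Modulo 2 the form is x² + xy + y², whose only zero is (0, 0).
odd-anisotropic : ∀ Q → ¬ + 2 ∣ a Q → ¬ + 2 ∣ b Q → ¬ + 2 ∣ c Q →
                  ∀ x y → + 2 ∣ Q ⟨ x , y ⟩ → + 2 ∣ x × + 2 ∣ y
odd-anisotropic (form a b c) 2∤a 2∤b 2∤c x y 2∣Q with + 2 ∣? x | + 2 ∣? y
... | yes 2∣x | yes 2∣y = 2∣x , 2∣y
... | yes 2∣x | no 2∤y  = contradiction
  (∣-lin₂ 1ℤ (- (a * x + b * y)) 2∣Q 2∣x (lemma a b c x y))
  (prime∤* prime[2] c (y * y) 2∤c (prime∤* prime[2] y y 2∤y 2∤y))
  where
  lemma : ∀ a b c x y → c * (y * y) ≡ 1ℤ * (a * (x * x) + b * (x * y) + c * (y * y)) + - (a * x + b * y) * x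
  lemma = solve-∀
... | no 2∤x  | yes 2∣y = contradiction
  (∣-lin₂ 1ℤ (- (b * x + c * y)) 2∣Q 2∣y (lemma a b c x y))
  (prime∤* prime[2] a (x * x) 2∤a (prime∤* prime[2] x x 2∤x 2∤x))
  where
  lemma : ∀ a b c x y → a * (x * x) ≡ 1ℤ * (a * (x * x) + b * (x * y) + c * (y * y)) + - (b * x + c * y) * y
  lemma = solve-∀
... | no 2∤x  | no 2∤y  = contradiction
  (∣m+n∣m⇒∣n 2∣Q (odd+odd (a * (x * x)) (b * (x * y))
    (prime∤* prime[2] a (x * x) 2∤a (prime∤* prime[2] x x 2∤x 2∤x))
    (prime∤* prime[2] b (x * y) 2∤b (prime∤* prime[2] x y 2∤x 2∤y))))
  (prime∤* prime[2] c (y * y) 2∤c (prime∤* prime[2] y y 2∤y 2∤y))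

odd-discriminant⇒2∤b : ∀ Q d → + 2 ∣ d - 1ℤ → + 8 ∣ discriminant Q - d → ¬ + 2 ∣ b Q
odd-discriminant⇒2∤b (form a b c) d 2∣d-1 8∣Δ-d 2∣b = prime∤1 prime[2]
  (∣-lin₂ 1ℤ -1ℤ (∣-lin₃ b -1ℤ (- (+ 2 * (a * c))) 2∣b (∣-trans (divides (+ 4) refl) 8∣Δ-d) (∣-refl {+ 2})
    (lemma a b c d)) 2∣d-1 (one d))
  where
  lemma : ∀ a b c d → d ≡ b * b + -1ℤ * (b * b - + 4 * (a * c) - d) + - (+ 2 * (a * c)) * + 2
  lemma = solve-∀
  one : ∀ d → 1ℤ ≡ 1ℤ * d + -1ℤ * (d - 1ℤ)
  one = solve-∀

-- Since b is odd, b² ≡ 1 modulo 8, so 8 ∣ 4ac. Thus a or c is even, and lifting applies in the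
-- corresponding variable.
Δ≡1⇒universal : ∀ Q → discriminant Q ≡ + 1 [mod 8 ] → ∀ e → Universal Q (2 ℕ.^ e)
Δ≡1⇒universal Q@(form a b c) 8∣Δ-1 = Sum.[ (λ 2∣a → hensel-universal prime[2] Q 2∣a 2∤b)
                                          , (λ 2∣c → hensel-universal′ prime[2] Q 2∣c 2∤b) ]
  (euclid prime[2] a c (*-cancelˡ-∣ (+ 4) {+ 2} {a * c}
    (∣-lin₂ -1ℤ 1ℤ 8∣Δ-1 (odd-square b 2∤b) (lemma a b c))))
  where
  2∤b : ¬ + 2 ∣ b
  2∤b = odd-discriminant⇒2∤b Q (+ 1) (divides 0ℤ refl) 8∣Δ-1
  lemma : ∀ a b c → + 4 * (a * c) ≡ -1ℤ * (b * b - + 4 * (a * c) - 1ℤ) + 1ℤ * (b * b - 1ℤ)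
  lemma = solve-∀

-- Since b² ≡ 1 modulo 8, here 8 ∣ 4(ac + 1), so all three coefficients are odd.
Δ≡5⇒ε≡2 : ∀ Q → discriminant Q ≡ + 5 [mod 8 ] → ε[ Q , 2 ]≡ [ 2 ]
Δ≡5⇒ε≡2 Q@(form a b c) 8∣Δ-5 = ε≡2 Q (odd-universal₂ Q 2∤a)
  (anisotropic⇒obstruction prime[2] Q (odd-anisotropic Q 2∤a 2∤b 2∤c))
  where
  2∤b : ¬ + 2 ∣ b
  2∤b = odd-discriminant⇒2∤b Q (+ 5) (divides (+ 2) refl) 8∣Δ-5
  lemma : ∀ a b c → + 4 * (a * c + 1ℤ) ≡ -1ℤ * (b * b - + 4 * (a * c) - + 5) + 1ℤ * (b * b - 1ℤ)
  lemma = solve-∀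
  2∤ac : ¬ + 2 ∣ a * c
  2∤ac 2∣ac = prime∤1 prime[2] (∣m+n∣m⇒∣n (*-cancelˡ-∣ (+ 4) {+ 2} {a * c + 1ℤ}
    (∣-lin₂ -1ℤ 1ℤ 8∣Δ-5 (odd-square b 2∤b) (lemma a b c))) 2∣ac)
  2∤a : ¬ + 2 ∣ a
  2∤a = 2∤ac ∘ ∣m⇒∣m*n c
  2∤c : ¬ + 2 ∣ c
  2∤c = 2∤ac ∘ ∣n⇒∣m*n a

-- The forms X² + Ny² modulo 4 and 8.

diagonal-mod : ∀ {k} {X y N r s n : ℤ} → k ∣ X - r → k ∣ y - s → k ∣ N - n →
               k ∣ (X * X + N * (y * y)) - (r * r + n * (s * s))
diagonal-mod {X = X} {y} {N} {r} {s} {n} X≡r y≡s N≡n =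
  ∣-lin₃ (X + r) (N * (y + s)) (s * s) X≡r y≡s N≡n (solve (X ∷ y ∷ N ∷ r ∷ s ∷ n ∷ []))

diagonal-mod⇒ : ∀ {k} (X y N r s n t : ℤ) → k ∣ X - r → k ∣ y - s → k ∣ N - n →
                k ∣ X * X + N * (y * y) - t → k ∣ r * r + n * (s * s) - t
diagonal-mod⇒ X y N r s n t X≡r y≡s N≡n eq =
  ∣-lin₂ 1ℤ -1ℤ eq (diagonal-mod {X = X} {y} {N} {r} {s} {n} X≡r y≡s N≡n)
    (solve (X ∷ y ∷ N ∷ r ∷ s ∷ n ∷ t ∷ []))

≡2mod4-residue : ∀ {k} (N n : ℤ) → + 4 ∣ k → k ∣ N - n → + 4 ∣ N - + 2 → + 4 ∣ n - + 2
≡2mod4-residue N n 4∣k N≡n N≡2 =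
  ∣-lin₂ 1ℤ -1ℤ N≡2 (∣-trans 4∣k N≡n) (solve (N ∷ n ∷ []))

-- Squares are 0 or 1 modulo 4, so the values are 0, 1, N and N + 1, which exhaust the residues only
-- for N ≡ 2.
diagonal-misses₄ : ∀ N → ¬ + 4 ∣ N - + 2 → ∃ λ t → ∀ X y → ¬ + 4 ∣ X * X + N * (y * y) - t
diagonal-misses₄ N N≢2 =
  let n , N≡n = residue 4 N
      t , miss = table n (λ n≡2 → N≢2 (∣-lin₂ 1ℤ 1ℤ N≡n n≡2 (lemma N (+ toℕ n))))
  in + toℕ t , λ X y eq →
    let r , X≡r = residue 4 X
        s , y≡s = residue 4 y
    in miss r s (diagonal-mod⇒ X y N (+ toℕ r) (+ toℕ s) (+ toℕ n) (+ toℕ t) X≡r y≡s N≡n eq)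
  where
  lemma : ∀ N n → N - + 2 ≡ 1ℤ * (N - n) + 1ℤ * (n - + 2)
  lemma = solve-∀
  table : ∀ (n : Fin 4) → ¬ + 4 ∣ + toℕ n - + 2 → ∃ λ (t : Fin 4) → ∀ (r s : Fin 4) →
          ¬ + 4 ∣ + toℕ r * + toℕ r + + toℕ n * (+ toℕ s * + toℕ s) - + toℕ t
  table = toWitness {a? = all? λ n → ¬? (+ 4 ∣? (+ toℕ n - + 2)) →-dec any? λ t → all? λ r → all? λ s →
    ¬? (+ 4 ∣? (+ toℕ r * + toℕ r + + toℕ n * (+ toℕ s * + toℕ s) - + toℕ t))} _

-- N is 2 or 6 modulo 8, and squares are 0, 1 or 4. The missed residues are 5, 7 in the first case
-- and 3, 5 in the second; 5 is common to both.
diagonal-misses₈ : ∀ N → + 4 ∣ N - + 2 → ∀ X y → ¬ + 8 ∣ X * X + N * (y * y) - + 5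
diagonal-misses₈ N N≡2 X y eq =
  let n , N≡n = residue 8 N
      r , X≡r = residue 8 X
      s , y≡s = residue 8 y
  in table n (≡2mod4-residue N (+ toℕ n) (divides (+ 2) refl) N≡n N≡2) r s
       (diagonal-mod⇒ X y N (+ toℕ r) (+ toℕ s) (+ toℕ n) (+ 5) X≡r y≡s N≡n eq)
  where
  table : ∀ (n : Fin 8) → + 4 ∣ + toℕ n - + 2 → ∀ (r s : Fin 8) →
          ¬ + 8 ∣ + toℕ r * + toℕ r + + toℕ n * (+ toℕ s * + toℕ s) - + 5
  table = toWitness {a? = all? λ n → (+ 4 ∣? (+ toℕ n - + 2)) →-dec all? λ r → all? λ s →
    ¬? (+ 8 ∣? (+ toℕ r * + toℕ r + + toℕ n * (+ toℕ s * + toℕ s) - + 5))} _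

diagonal-universal₄ : ∀ N → + 4 ∣ N - + 2 → ∀ l → ∃₂ λ X y → + 4 ∣ X * X + N * (y * y) - l
diagonal-universal₄ N N≡2 l =
  let t , l≡t = residue 4 l
      r , s , eq = table t
  in + toℕ r , + toℕ s ,
     ∣-lin₃ 1ℤ -1ℤ (+ toℕ s * + toℕ s) eq l≡t N≡2 (lemma N l (+ toℕ t) (+ toℕ r) (+ toℕ s))
  where
  lemma : ∀ N l t r s → r * r + N * (s * s) - l ≡
          1ℤ * (r * r + + 2 * (s * s) - t) + -1ℤ * (l - t) + s * s * (N - + 2)
  lemma = solve-∀
  table : ∀ (t : Fin 4) → ∃₂ λ (r s : Fin 4) → + 4 ∣ + toℕ r * + toℕ r + + 2 * (+ toℕ s * + toℕ s) - + toℕ t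
  table = toWitness {a? = all? λ t → any? λ r → any? λ s →
    + 4 ∣? (+ toℕ r * + toℕ r + + 2 * (+ toℕ s * + toℕ s) - + toℕ t)} _

-- The prime 2: even discriminants.

-- The middle coefficient is b = 2β, so that N = ac − β² is −Δ/4.
completed-square : ∀ a β c x y → let X = a * x + β * y in
  a * (a * (x * x) + β * + 2 * (x * y) + c * (y * y)) ≡ X * X + (a * c - β * β) * (y * y)
completed-square = solve-∀

-- An odd a is its own inverse modulo 8, hence modulo k, so multiplying by a passes to the completed
-- square.
even-obstruction : ∀ {k} a β c → ¬ + 2 ∣ a → + k ∣ + 8 → ∀ t →
                   (∀ X y → ¬ + k ∣ X * X + (a * c - β * β) * (y * y) - t) →
                   HasLocalObstruction (form a (β * + 2) c) k
even-obstruction {k} a β c 2∤a k∣8 t misses =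
  unit-obstruction (form a (β * + 2) c) k a a t (∣-trans k∣8 (odd-square a 2∤a)) λ x y eq →
    misses (a * x + β * y) y (subst (λ q → + k ∣ q - t) (completed-square a β c x y) eq)

even-universal₄ : ∀ a β c → ¬ + 2 ∣ a → + 4 ∣ a * c - β * β - + 2 → Universal (form a (β * + 2) c) 4
even-universal₄ a β c 2∤a N≡2 l =
  let X , y , eq = diagonal-universal₄ (a * c - β * β) N≡2 (a * l)
      -- This x solves ax + βy ≡ X modulo 4, again because a² ≡ 1.
      x = a * (X - β * y)
  in x , y , cancel-unit a a _ unit
       (∣-lin₂ 1ℤ ((a * x + β * y + X) * (X - β * y)) eq unit (lemma a β c l X y))
  where
  unit : + 4 ∣ a * a - 1ℤ
  unit = ∣-trans (divides (+ 2) refl) (odd-square a 2∤a)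
  lemma : ∀ a β c l X y → let x = a * (X - β * y) in
    a * (a * (x * x) + β * + 2 * (x * y) + c * (y * y) - l) ≡
    1ℤ * (X * X + (a * c - β * β) * (y * y) - a * l) + (a * x + β * y + X) * (X - β * y) * (a * a - 1ℤ)
  lemma = solve-∀

even-ε : ∀ Q → ¬ + 2 ∣ a Q → ∀ N → discriminant Q ≡ - (+ 4 * N) →
         (+ 4 ∣ N - + 2 → ε[ Q , 2 ]≡ [ 3 ]) × (¬ + 4 ∣ N - + 2 → ε[ Q , 2 ]≡ [ 2 ])
-- Δ = -4N makes b² even, hence b = 2β, and then N = ac - β².
even-ε Q@(form a b c) 2∤a N Δ≡-4N with prime∣square prime[2] b (divides (+ 2 * (a * c - N))
  (trans (cancel a b c) (trans (cong (_+ + 4 * (a * c)) Δ≡-4N) (double (a * c) N))))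
  where
  cancel : ∀ a b c → b * b ≡ b * b - + 4 * (a * c) + + 4 * (a * c)
  cancel = solve-∀
  double : ∀ t N → - (+ 4 * N) + + 4 * t ≡ + 2 * (t - N) * + 2
  double = solve-∀
... | divides β refl = ε≡[3] , ε≡[2]
  where
  N≡ : a * c - β * β ≡ N
  N≡ = ℤ.*-cancelˡ-≡ (+ 4) _ _ (ℤ.neg-injective (trans (lemma a β c) Δ≡-4N))
    where
    lemma : ∀ a β c → - (+ 4 * (a * c - β * β)) ≡ β * + 2 * (β * + 2) - + 4 * (a * c)
    lemma = solve-∀

  ε≡[2] : ¬ + 4 ∣ N - + 2 → ε[ Q , 2 ]≡ [ 2 ]
  ε≡[2] N≢2 =
    let t , misses = diagonal-misses₄ (a * c - β * β) (N≢2 ∘ subst (λ N → + 4 ∣ N - + 2) N≡)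
    in ε≡2 Q (odd-universal₂ Q 2∤a) (even-obstruction a β c 2∤a (divides (+ 2) refl) t misses)

  ε≡[3] : + 4 ∣ N - + 2 → ε[ Q , 2 ]≡ [ 3 ]
  ε≡[3] N≡2 = (s≤s z≤n , even-obstruction a β c 2∤a ∣-refl (+ 5) (diagonal-misses₈ (a * c - β * β) N≡2′)) , least
    where
    N≡2′ : + 4 ∣ a * c - β * β - + 2
    N≡2′ = subst (λ N → + 4 ∣ N - + 2) (sym N≡) N≡2
    least : ∀ m → 1 ℕ.≤ m × HasLocalObstruction Q (2 ℕ.^ m) → 3 ℕ.≤ m
    least 1 (_ , obs) = contradiction obs (universal⇒unobstructed Q (odd-universal₂ Q 2∤a))
    least 2 (_ , obs) = contradiction obs (universal⇒unobstructed Q (even-universal₄ a β c 2∤a N≡2′))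
    least (ℕ.suc (ℕ.suc (ℕ.suc _))) _ = s≤s (s≤s (s≤s z≤n))

-- Sign and 2-adic shape of the discriminant.

2^[2+k]*m≡4*2^k*m : ∀ k m → 2 ℕ.^ (2 ℕ.+ k) ℕ.* m ≡ 4 ℕ.* (2 ℕ.^ k ℕ.* m)
2^[2+k]*m≡4*2^k*m k m =
  trans (cong (ℕ._* m) (ℕ.^-distribˡ-+-* 2 2 k)) (ℕ.*-assoc 4 (2 ℕ.^ k) m)

-2^[2+k]*m≡-4*2^k*m : ∀ k m → - + (2 ℕ.^ (2 ℕ.+ k) ℕ.* m) ≡ - (+ 4 * + (2 ℕ.^ k ℕ.* m))
-2^[2+k]*m≡-4*2^k*m k m =
  cong -_ (trans (cong +_ (2^[2+k]*m≡4*2^k*m k m)) (ℤ.pos-* 4 (2 ℕ.^ k ℕ.* m)))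

2m≡2mod4 : ∀ m → Odd m → + 4 ∣ + (2 ℕ.* m) - + 2
2m≡2mod4 m odd with 2∤⇒1+2u (+ m) (odd ∘ ∣⇒∣ᵤ)
... | u , m≡ = divides u (trans (cong (_- + 2) (trans (ℤ.pos-* 2 m) (cong (+ 2 *_) m≡))) (lemma u))
  where
  lemma : ∀ u → + 2 * (1ℤ + + 2 * u) - + 2 ≡ u * + 4
  lemma = solve-∀

-- The number is odd for k = 0 and divisible by 4 for k ≥ 2. With k = n - 2, the excluded k = 1 is
-- the case n = 3 of the theorem.
2^k*m≢2mod4 : ∀ k m → Odd m → k ≢ 1 → ¬ + 4 ∣ + (2 ℕ.^ k ℕ.* m) - + 2
2^k*m≢2mod4 0 m odd _ 4∣m-2 = odd (∣⇒∣ᵤ (subst (λ m → + 2 ∣ + m) (ℕ.*-identityˡ m)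
  (∣-lin₂ 1ℤ 1ℤ (∣-trans (divides (+ 2) refl) 4∣m-2) (∣-refl {+ 2}) (lemma (+ (1 ℕ.* m))))))
  where
  lemma : ∀ m → m ≡ 1ℤ * (m - + 2) + 1ℤ * + 2
  lemma = solve-∀
2^k*m≢2mod4 1 m _ k≢1 _ = k≢1 refl
2^k*m≢2mod4 (ℕ.suc (ℕ.suc k)) m _ _ 4∣ = from-no (+ 4 ∣? - + 2)
  (∣m+n∣m⇒∣n {m = + (2 ℕ.^ (2 ℕ.+ k) ℕ.* m)} 4∣
    (∣ᵤ⇒∣ (subst (4 ℕ.∣_) (sym (2^[2+k]*m≡4*2^k*m k m)) (ℕ.m∣m*n (2 ℕ.^ k ℕ.* m)))))

-- Q(1, 0) = a and Q(-b, 2a) = -aΔ are both positive, and the factor a cancels.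
positive-definite⇒Δ<0 : ∀ Q → PositiveDefinite Q → 0ℤ ℤ.< - discriminant Q
positive-definite⇒Δ<0 (form a b c) pos = from-a a refl (subst (0ℤ ℤ.<_) (at-1,0 a b c) (pos 1ℤ 0ℤ λ ()))
  where
  at-1,0 : ∀ a b c → a * (1ℤ * 1ℤ) + b * (1ℤ * 0ℤ) + c * (0ℤ * 0ℤ) ≡ a
  at-1,0 = solve-∀
  at-−b,2a : ∀ a b c → a * (- b * - b) + b * (- b * (+ 2 * a)) + c * (+ 2 * a * (+ 2 * a)) ≡
             a * - (b * b - + 4 * (a * c))
  at-−b,2a = solve-∀
  from-a : ∀ a′ → a ≡ a′ → 0ℤ ℤ.< a′ → 0ℤ ℤ.< - (b * b - + 4 * (a * c))
  from-a .(+ ℕ.suc n) refl (+<+ (s≤s {n = n} z≤n)) = ℤ.*-cancelˡ-<-nonNeg a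
    (subst₂ ℤ._<_ (sym (ℤ.*-zeroʳ a)) (at-−b,2a a b c) (pos (- b) (+ 2 * a) λ ()))

two-part : ∀ n → 0 ℕ.< n → ∃₂ λ k m → 0 ℕ.< m × Odd m × n ≡ 2 ℕ.^ k ℕ.* m
two-part n = go n (<-wellFounded n)
  where
  go : ∀ n → Acc ℕ._<_ n → 0 ℕ.< n → ∃₂ λ k m → 0 ℕ.< m × Odd m × n ≡ 2 ℕ.^ k ℕ.* m
  go n (acc rec) 0<n with 2 ℕ.∣? n
  ... | no odd = 0 , n , 0<n , odd , sym (ℕ.*-identityˡ n)
  ... | yes (ℕ.divides q@(ℕ.suc _) refl) with go q (rec (ℕ.m<m*n q 2 (s≤s (s≤s z≤n)))) (s≤s z≤n)
  ... | k , m , 0<m , odd , q≡ = ℕ.suc k , m , 0<m , odd , (begin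
    q ℕ.* 2                   ≡⟨ ℕ.*-comm q 2 ⟩
    2 ℕ.* q                   ≡⟨ cong (2 ℕ.*_) q≡ ⟩
    2 ℕ.* (2 ℕ.^ k ℕ.* m)     ≡⟨ ℕ.*-assoc 2 (2 ℕ.^ k) m ⟨
    2 ℕ.^ ℕ.suc k ℕ.* m       ∎)
    where open ≡-Reasoning

negative-4∣⇒ : ∀ z → 0ℤ ℤ.< - z → + 4 ∣ z →
               ∃₂ λ n m → 2 ℕ.≤ n × 0 ℕ.< m × Odd m × z ≡ - (+ (2 ℕ.^ n ℕ.* m))
negative-4∣⇒ z 0<-z (divides w refl) =
  from (- w) refl (ℤ.*-cancelʳ-<-nonNeg (+ 4) (subst (0ℤ ℤ.<_) (ℤ.neg-distribˡ-* w (+ 4)) 0<-z))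
  where
  open ≡-Reasoning
  lemma : ∀ w → w * + 4 ≡ - (+ 4 * - w)
  lemma = solve-∀
  from : ∀ v → - w ≡ v → 0ℤ ℤ.< v →
         ∃₂ λ n m → 2 ℕ.≤ n × 0 ℕ.< m × Odd m × w * + 4 ≡ - (+ (2 ℕ.^ n ℕ.* m))
  from (+ v) -w≡ (+<+ 0<v) with two-part v 0<v
  ... | k , m , 0<m , odd , v≡ = 2 ℕ.+ k , m , s≤s (s≤s z≤n) , 0<m , odd , (begin
    w * + 4                        ≡⟨ lemma w ⟩
    - (+ 4 * - w)                  ≡⟨ cong (λ t → - (+ 4 * t)) -w≡ ⟩
    - (+ 4 * + v)                  ≡⟨ cong (λ t → - (+ 4 * + t)) v≡ ⟩
    - (+ 4 * + (2 ℕ.^ k ℕ.* m))    ≡⟨ -2^[2+k]*m≡-4*2^k*m k m ⟨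
    - + (2 ℕ.^ (2 ℕ.+ k) ℕ.* m)    ∎)

-- For even b, 4 ∣ Δ. For odd b, Δ ≡ 1 - 4ac modulo 8, and the parity of ac decides.
discriminant-cases : ∀ Q → discriminant Q ≡ + 1 [mod 8 ] ⊎ discriminant Q ≡ + 5 [mod 8 ] ⊎ + 4 ∣ discriminant Q
discriminant-cases (form a b c) with + 2 ∣? b
... | yes (divides β refl) = inj₂ (inj₂ (divides (β * β - a * c) (lemma a β c)))
  where
  lemma : ∀ a β c → β * + 2 * (β * + 2) - + 4 * (a * c) ≡ (β * β - a * c) * + 4
  lemma = solve-∀
... | no 2∤b with parity (a * c)
... | inj₁ (u , ac≡) = inj₁ (∣-lin₂ 1ℤ (- u) (odd-square b 2∤b) (∣-refl {+ 8})
  (trans (cong (λ t → b * b - + 4 * t - + 1) ac≡) (lemma b u)))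
  where
  lemma : ∀ b u → b * b - + 4 * (+ 2 * u) - + 1 ≡ 1ℤ * (b * b - 1ℤ) + - u * + 8
  lemma = solve-∀
... | inj₂ (u , ac≡) = inj₂ (inj₁ (∣-lin₂ 1ℤ (- u - 1ℤ) (odd-square b 2∤b) (∣-refl {+ 8})
  (trans (cong (λ t → b * b - + 4 * t - + 5) ac≡) (lemma b u))))
  where
  lemma : ∀ b u → b * b - + 4 * (1ℤ + + 2 * u) - + 5 ≡ 1ℤ * (b * b - 1ℤ) + (- u - 1ℤ) * + 8
  lemma = solve-∀

-- The last component records that the cases for p = 2 exhaust all discriminants; positive
-- definiteness enters there through Δ < 0, which makes m positive.
theorem1p2 :
  (Q : BinaryQuadraticForm) → Primitive Q → PositiveDefinite Q →
  let Δ = discriminant Q in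
  (∀ p → Prime p → p ≢ 2 →
    (legendre Δ p ≡ 0ℤ → ε[ Q , p ]≡ [ 1 ]) ×
    (legendre Δ p ≡ -1ℤ → ε[ Q , p ]≡ [ 2 ]) ×
    (legendre Δ p ≡ 1ℤ → ε[ Q , p ]≡ ⊤⁺)) ×
  ((Δ ≡ + 1 [mod 8 ] → ε[ Q , 2 ]≡ ⊤⁺) ×
   (Δ ≡ + 5 [mod 8 ] → ε[ Q , 2 ]≡ [ 2 ]) ×
   (∀ m → + 4 ∣ Δ → 0 ℕ.< m → Odd m → Δ ≡ - (+ (2 ℕ.^ 3 ℕ.* m)) → ε[ Q , 2 ]≡ [ 3 ]) ×
   (∀ n m → + 4 ∣ Δ → 0 ℕ.< m → Odd m → 2 ℕ.≤ n → n ≢ 3 → Δ ≡ - (+ (2 ℕ.^ n ℕ.* m)) → ε[ Q , 2 ]≡ [ 2 ]) ×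
   (Δ ≡ + 1 [mod 8 ] ⊎ Δ ≡ + 5 [mod 8 ] ⊎
    + 4 ∣ Δ × ∃₂ λ (n m : ℕ) → 2 ℕ.≤ n × 0 ℕ.< m × Odd m × Δ ≡ - (+ (2 ℕ.^ n ℕ.* m))))
theorem1p2 Q prim pos = odd-part ,
  (λ Δ≡1 → ε≡∞ Q (Δ≡1⇒universal Q Δ≡1)) ,
  Δ≡5⇒ε≡2 Q ,
  -- Here N = -Δ/4 is 2m with m odd, so N ≡ 2 modulo 4.
  (λ m 4∣Δ _ odd Δ≡ → wlog-∤a prime[2] Q prim (2∣ 4∣Δ) [ 3 ] λ Q′ Δ′≡Δ 2∤a →
    proj₁ (even-ε Q′ 2∤a (+ (2 ℕ.* m)) (trans Δ′≡Δ (trans Δ≡ (-2^[2+k]*m≡-4*2^k*m 1 m)))) (2m≡2mod4 m odd)) ,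
  (λ { (ℕ.suc (ℕ.suc k)) m 4∣Δ _ odd _ n≢3 Δ≡ → wlog-∤a prime[2] Q prim (2∣ 4∣Δ) [ 2 ] λ Q′ Δ′≡Δ 2∤a →
    proj₂ (even-ε Q′ 2∤a (+ (2 ℕ.^ k ℕ.* m)) (trans Δ′≡Δ (trans Δ≡ (-2^[2+k]*m≡-4*2^k*m k m))))
      (2^k*m≢2mod4 k m odd (n≢3 ∘ cong (2 ℕ.+_)))
     ; 1 _ _ _ _ (s≤s ()) }) ,
  Sum.map₂ (Sum.map₂ λ 4∣Δ → 4∣Δ , negative-4∣⇒ (discriminant Q) (positive-definite⇒Δ<0 Q pos) 4∣Δ)
    (discriminant-cases Q)
  where
  2∣ : + 4 ∣ discriminant Q → + 2 ∣ discriminant Q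
  2∣ = ∣-trans (divides (+ 2) refl)

  odd-part : ∀ p → Prime p → p ≢ 2 →
    (legendre (discriminant Q) p ≡ 0ℤ → ε[ Q , p ]≡ [ 1 ]) ×
    (legendre (discriminant Q) p ≡ -1ℤ → ε[ Q , p ]≡ [ 2 ]) ×
    (legendre (discriminant Q) p ≡ 1ℤ → ε[ Q , p ]≡ ⊤⁺)
  odd-part p pp p≢2 =
    (λ eq → wlog-∤a pp Q prim (legendre≡0⇒ (discriminant Q) p eq) [ 1 ] λ Q′ Δ′≡Δ p∤a →
      ε≡1 Q′ (ramified pp p≢2 Q′ (subst (+ p ∣_) (sym Δ′≡Δ) (legendre≡0⇒ (discriminant Q) p eq)) p∤a)) ,
    (λ eq → let p∤Δ , nonsquare = legendre≡-1⇒ (discriminant Q) p {{prime⇒nonZero pp}} eq in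
      ε≡2 Q (inert-universal pp p≢2 Q p∤Δ (inert⇒∤a Q nonsquare))
        (anisotropic⇒obstruction pp Q (inert-anisotropic pp p≢2 Q nonsquare))) ,
    (λ eq → let p∤Δ , s , s²≡Δ = legendre≡1⇒ (discriminant Q) p eq in
      ε≡∞ Q (split-universal pp p≢2 Q s p∤Δ s²≡Δ))
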